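{- $(\mathbf{M},E_0)$ is an effectively inseparable pair: there is a total computable $f:\mathbb{N}^2\to\mathbb{N}$ such that whenever $\mathbf{M}\subseteq W_i$, $E_0\subseteq W_j$ and $W_i\cap W_j=\varnothing$, then $f(i,j)\notin W_i\cup W_j$.
   Context: $(\varphi_e)_{e\in\mathbb{N}}$ is a fixed standard acceptable numbering of the unary partial computable functions and $W_e=\operatorname{dom}\varphi_e$. $\mathbf{M}=\{p\in\mathbb{N}:\varphi_p(0)\!\downarrow=1\}$ and $E_0=\{p\in\mathbb{N}:\varphi_p(0)\!\downarrow=0\}$. -}

module Defs where

open import Data.Fin.Base using (Fin)
open import Data.Nat.Base using (ℕ; zero; suc; _<_)
open import Data.Product.Base using (∃; _×_)
open import Data.Vec.Base using (Vec; []; _∷_; lookup)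
open import Data.Vec.Relation.Binary.Pointwise.Inductive using (Pointwise)
open import Function.Bundles using (_⇔_)
open import Level using (0ℓ)
open import Relation.Binary.PropositionalEquality.Core using (_≡_)
open import Relation.Unary using (Pred; _∈_; _∉_; _⊆_; _∩_; _∪_; Empty)

-- Kleene's μ-recursive functions.

data Rec : ℕ → Set where
  zeroᵣ : Rec 0
  sucᵣ  : Rec 1
  proj  : ∀ {n} → Fin n → Rec n
  comp  : ∀ {n m} → Rec m → Vec (Rec n) m → Rec n
  prec  : ∀ {n} → Rec n → Rec (suc (suc n)) → Rec (suc n)
  min   : ∀ {n} → Rec (suc n) → Rec n

infix 4 _[_]⇓_

-- t [ xs ]⇓ y : the partial function denoted by t is defined at xs, with
-- value y.  Primitive recursion is on the first argument, and its step
-- function receives the counter, then the previous value, then the parameters.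
-- min searches for the least zero in the first argument, and requires t to be
-- defined at all smaller arguments.

data _[_]⇓_ : ∀ {n} → Rec n → Vec ℕ n → ℕ → Set where
  ⇓zero : zeroᵣ [ [] ]⇓ zero
  ⇓suc  : ∀ {x} → sucᵣ [ x ∷ [] ]⇓ suc x
  ⇓proj : ∀ {n} {xs : Vec ℕ n} (i : Fin n) → proj i [ xs ]⇓ lookup xs i
  ⇓comp : ∀ {n m} {t : Rec m} {us : Vec (Rec n) m} {xs ys z} →
          Pointwise (λ u y → u [ xs ]⇓ y) us ys →
          t [ ys ]⇓ z →
          comp t us [ xs ]⇓ z
  ⇓prec-zero : ∀ {n} {t : Rec n} {u xs y} →
          t [ xs ]⇓ y →
          prec t u [ zero ∷ xs ]⇓ y
  ⇓prec-suc  : ∀ {n} {t : Rec n} {u xs k r y} →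
          prec t u [ k ∷ xs ]⇓ r →
          u [ k ∷ r ∷ xs ]⇓ y →
          prec t u [ suc k ∷ xs ]⇓ y
  ⇓min  : ∀ {n} {t : Rec (suc n)} {xs y} →
          (∀ k → k < y → ∃ λ r → t [ k ∷ xs ]⇓ suc r) →
          t [ y ∷ xs ]⇓ zero →
          min t [ xs ]⇓ y

-- Partial functions are represented by their graphs.

PartialComputable : ∀ {n} → (Vec ℕ n → ℕ → Set) → Set
PartialComputable {n} g = ∃ λ (t : Rec n) → ∀ xs y → g xs y ⇔ t [ xs ]⇓ y

Computable : ∀ {n} → (Vec ℕ n → ℕ) → Set
Computable f = PartialComputable λ xs y → f xs ≡ y

-- A numbering of the unary partial computable functions is acceptable when it
-- has a partial computable universal function and satisfies the s-m-n property.
-- Here φ e x y means φₑ(x)↓ = y.  Functionality of each φₑ follows from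
-- universal.  The case m = 0 of smn says that every unary partial computable
-- function occurs in the numbering.  In smn the remaining variable x precedes
-- the m parameters.

record AcceptableNumbering : Set₁ where
  field
    φ         : ℕ → ℕ → ℕ → Set
    universal : PartialComputable {2} λ { (e ∷ x ∷ []) y → φ e x y }
    smn       : ∀ {m} (t : Rec (suc m)) →
                ∃ λ (s : Vec ℕ m → ℕ) → Computable s ×
                  (∀ as x y → φ (s as) x y ⇔ t [ x ∷ as ]⇓ y)

  W : ℕ → Pred ℕ 0ℓ
  W e x = ∃ λ y → φ e x y

  𝐌 : Pred ℕ 0ℓ
  𝐌 p = φ p 0 1

  E₀ : Pred ℕ 0ℓ
  E₀ p = φ p 0 0

  EffectivelyInseparable : Pred ℕ 0ℓ → Pred ℕ 0ℓ → Set
  EffectivelyInseparable A B =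
    ∃ λ (f : ℕ → ℕ → ℕ) →
      Computable {2} (λ { (i ∷ j ∷ []) → f i j }) ×
      (∀ i j → A ⊆ W i → B ⊆ W j → Empty (W i ∩ W j) → f i j ∉ W i ∪ W j)

{-# OPTIONS --safe #-}

-- Given i and j, the recursion theorem provides p such that φₚ searches for p
-- in Wᵢ and Wⱼ simultaneously, and outputs 0 if it is found in Wᵢ first, 1 if it
-- is found in Wⱼ first.  If p lay in Wᵢ ∪ Wⱼ, then output 0 would give p ∈ Wᵢ and
-- p ∈ E₀ ⊆ Wⱼ, and output 1 would give p ∈ Wⱼ and p ∈ 𝐌 ⊆ Wᵢ.
--
-- The simultaneous search needs step-bounded evaluation.  As the program is
-- fixed, no coding of programs is needed: a bounded evaluator is defined for each
-- term by recursion on the term, the bound being imposed on every use of min.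

module Submission where

open import Defs
open import Data.Fin.Base using (Fin; zero; suc; _↑ʳ_)
open import Data.Fin.Patterns using (0F; 1F; 2F; 3F)
open import Data.Nat.Base using (ℕ; zero; suc; _+_; _<_; _≤_; _⊔_; s≤s⁻¹)
open import Data.Nat.Properties
  using (≤-refl; ≤-trans; m⊔n≤o⇒m≤o; m⊔n≤o⇒n≤o; n≤1+n; m≤n⇒m<n∨m≡n)
open import Data.Product.Base as Product using (∃; _×_; _,_; proj₁; proj₂)
open import Data.Sum.Base as Sum using (_⊎_; inj₁; inj₂; [_,_])
open import Data.Unit.Base using (⊤; tt)
open import Data.Vec.Base using (Vec; []; _∷_; _++_; lookup; map; tabulate)
open import Data.Vec.Properties using (lookup-++ʳ; tabulate-cong; tabulate∘lookup; ∷-injective)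
open import Data.Vec.Relation.Binary.Pointwise.Inductive using (Pointwise; []; _∷_)
open import Function.Base using (id; _∘_)
open import Function.Bundles using (module Equivalence; mk⇔)
open import Relation.Binary.PropositionalEquality
  using (_≡_; refl; sym; trans; cong; cong₂; subst)
open import Relation.Unary using (_∪_)

open Equivalence using (to; from)

private
  variable
    m n : ℕ

-- Primitive recursive terms

-- Total terms with a computing semantics: facts about the bounded evaluator become equations in
-- `ℕ`, proved by rewriting, and `toRec` carries them over to `Rec`.
data PR : ℕ → Set where
  zeroₚ : PR n
  sucₚ  : PR n → PR n
  var   : Fin n → PR n
  app   : PR m → Vec (PR n) m → PR n
  prec  : PR n → PR (suc (suc n)) → PR (suc n)

⟦_⟧  : PR n → Vec ℕ n → ℕ
⟦_⟧* : Vec (PR n) m → Vec ℕ n → Vec ℕ m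

⟦ zeroₚ ⟧    xs           = zero
⟦ sucₚ p ⟧   xs           = suc (⟦ p ⟧ xs)
⟦ var i ⟧    xs           = lookup xs i
⟦ app p qs ⟧ xs           = ⟦ p ⟧ (⟦ qs ⟧* xs)
⟦ prec p q ⟧ (zero ∷ xs)  = ⟦ p ⟧ xs
⟦ prec p q ⟧ (suc k ∷ xs) = ⟦ q ⟧ (k ∷ ⟦ prec p q ⟧ (k ∷ xs) ∷ xs)

⟦ [] ⟧*     xs = []
⟦ p ∷ ps ⟧* xs = ⟦ p ⟧ xs ∷ ⟦ ps ⟧* xs

toRec  : PR n → Rec n
toRec* : Vec (PR n) m → Vec (Rec n) m

toRec zeroₚ      = comp zeroᵣ []
toRec (sucₚ p)   = comp sucᵣ (toRec p ∷ [])
toRec (var i)    = proj i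
toRec (app p qs) = comp (toRec p) (toRec* qs)
toRec (prec p q) = prec (toRec p) (toRec q)

toRec* []       = []
toRec* (p ∷ ps) = toRec p ∷ toRec* ps

toRec-⇓  : (p : PR n) (xs : Vec ℕ n) → toRec p [ xs ]⇓ ⟦ p ⟧ xs
toRec*-⇓ : (ps : Vec (PR n) m) (xs : Vec ℕ n) →
           Pointwise (λ u y → u [ xs ]⇓ y) (toRec* ps) (⟦ ps ⟧* xs)

toRec-⇓ zeroₚ      xs           = ⇓comp [] ⇓zero
toRec-⇓ (sucₚ p)   xs           = ⇓comp (toRec-⇓ p xs ∷ []) ⇓suc
toRec-⇓ (var i)    xs           = ⇓proj i
toRec-⇓ (app p qs) xs           = ⇓comp (toRec*-⇓ qs xs) (toRec-⇓ p _)
toRec-⇓ (prec p q) (zero ∷ xs)  = ⇓prec-zero (toRec-⇓ p xs)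
toRec-⇓ (prec p q) (suc k ∷ xs) = ⇓prec-suc (toRec-⇓ (prec p q) (k ∷ xs)) (toRec-⇓ q _)

toRec*-⇓ []       xs = []
toRec*-⇓ (p ∷ ps) xs = toRec-⇓ p xs ∷ toRec*-⇓ ps xs

predₚ : PR n → PR n
predₚ p = app (prec zeroₚ (var 0F)) (p ∷ [])

if0_then_else_ : PR n → PR n → PR n → PR n
if0 p then q else r = app (prec (var 0F) (var 3F)) (p ∷ q ∷ r ∷ [])

params : ∀ m → Vec (PR (m + n)) n
params m = tabulate (var ∘ (m ↑ʳ_))

⟦params⟧ : (ys : Vec ℕ m) (xs : Vec ℕ n) → ⟦ params m ⟧* (ys ++ xs) ≡ xs
⟦params⟧ {m} {n} ys xs =
  trans (⟦tabulate⟧ (m ↑ʳ_))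
    (trans (tabulate-cong (lookup-++ʳ ys xs)) (tabulate∘lookup xs))
  where
  ⟦tabulate⟧ : ∀ {l k} {zs : Vec ℕ l} (ρ : Fin k → Fin l) →
               ⟦ tabulate (var ∘ ρ) ⟧* zs ≡ tabulate (lookup zs ∘ ρ)
  ⟦tabulate⟧ {k = zero}       ρ = refl
  ⟦tabulate⟧ {k = suc k} {zs} ρ = cong (lookup zs (ρ zero) ∷_) (⟦tabulate⟧ (ρ ∘ suc))

-- Composition is strict: with 0 encoding no result, one failing component makes the value 0, even
-- where `q` would ignore that component.
guard : Vec (PR n) m → PR n → PR n
guard []       q = q
guard (p ∷ ps) q = if0 p then zeroₚ else guard ps q

guard-suc⁻ : (ps : Vec (PR n) m) {q : PR n} {xs : Vec ℕ n} {y : ℕ} →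
             ⟦ guard ps q ⟧ xs ≡ suc y →
             ⟦ ps ⟧* xs ≡ map suc (⟦ map predₚ ps ⟧* xs) × ⟦ q ⟧ xs ≡ suc y
guard-suc⁻ []       eq = refl , eq
guard-suc⁻ (p ∷ ps) {xs = xs} eq with ⟦ p ⟧ xs
... | suc _ = let ps≡ , q≡ = guard-suc⁻ ps eq in cong (_ ∷_) ps≡ , q≡

guard-suc : (ps : Vec (PR n) m) {q : PR n} {xs : Vec ℕ n} (ys : Vec ℕ m) →
            ⟦ ps ⟧* xs ≡ map suc ys →
            ⟦ map predₚ ps ⟧* xs ≡ ys × ⟦ guard ps q ⟧ xs ≡ ⟦ q ⟧ xs
guard-suc []       []       eq = refl , refl
guard-suc (p ∷ ps) {xs = xs} (y ∷ ys) eq with ⟦ p ⟧ xs | ∷-injective eq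
... | _ | refl , ps≡ = let preds≡ , g≡ = guard-suc ps ys ps≡ in cong (y ∷_) preds≡ , g≡

-- Step-bounded evaluation

-- The step of the search for y at which p has value 1 (encoding 0), with variables
-- counter, state, bound, parameters.  State 0 means that the search goes on,
-- 1 that an undefined value was met, and 2 + y that y was found.
searchStep : PR (suc (suc n)) → PR (suc (suc (suc n)))
searchStep p =
  if0 var 1F
  then (if0 v then sucₚ zeroₚ else (if0 predₚ v then sucₚ (sucₚ (var 0F)) else zeroₚ))
  else var 1F
  where v = app p (var 2F ∷ var 0F ∷ params 3)

search : PR (suc (suc n)) → PR (suc (suc n))
search p = prec zeroₚ (searchStep p)

-- The variables are counter, state, bound, parameters. State 0, no result, is absorbing; `predₚ`
-- decodes any other state.
precStep : PR (suc (suc (suc n))) → PR (suc (suc (suc n)))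
precStep p = if0 var 1F then zeroₚ else app p (var 2F ∷ var 0F ∷ predₚ (var 1F) ∷ params 3)

-- The first variable of approx t is the bound s.  The value is 0 if no result
-- is obtained within the bound, and 1 + y if the result is y.
approx  : Rec n → PR (suc n)
approx* : Vec (Rec n) m → Vec (PR (suc n)) m

approx zeroᵣ       = sucₚ zeroₚ
approx sucᵣ        = sucₚ (sucₚ (var 1F))
approx (proj i)    = sucₚ (var (suc i))
approx (comp t us) = guard (approx* us) (app (approx t) (var 0F ∷ map predₚ (approx* us)))
approx (prec t u)  = app (prec (approx t) (precStep (approx u))) (var 1F ∷ var 0F ∷ params 2)
-- The bound limits both the number of search steps and each evaluation of `t`. `predₚ` sends the
-- states 0 and 1 to 0, no result, and 2 + y to 1 + y.
approx (min t)     = predₚ (app (search (approx t)) (var 0F ∷ var 0F ∷ params 1))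

approx* []       = []
approx* (u ∷ us) = approx u ∷ approx* us

-- Soundness of bounded evaluation

approx-prec : (t : Rec n) (u : Rec (suc (suc n))) (s k : ℕ) (xs : Vec ℕ n) →
              ⟦ approx (prec t u) ⟧ (s ∷ k ∷ xs) ≡ ⟦ prec (approx t) (precStep (approx u)) ⟧ (k ∷ s ∷ xs)
approx-prec t u s k xs rewrite ⟦params⟧ (s ∷ k ∷ []) xs = refl

-- The invariant of the search: what its state certifies after `k` steps. State 1 certifies nothing,
-- the search having been abandoned.
Found : Rec (suc n) → Vec ℕ n → ℕ → ℕ → Set
Found t xs k zero          = ∀ j → j < k → ∃ λ r → t [ j ∷ xs ]⇓ suc r
Found t xs k (suc zero)    = ⊤
Found t xs k (suc (suc y)) = min t [ xs ]⇓ y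

approx-sound  : (t : Rec n) (s : ℕ) (xs : Vec ℕ n) {y : ℕ} →
                ⟦ approx t ⟧ (s ∷ xs) ≡ suc y → t [ xs ]⇓ y
approx*-sound : (us : Vec (Rec n) m) (s : ℕ) (xs : Vec ℕ n) {ys : Vec ℕ m} →
                ⟦ approx* us ⟧* (s ∷ xs) ≡ map suc ys → Pointwise (λ u y → u [ xs ]⇓ y) us ys
prec-sound    : (t : Rec n) (u : Rec (suc (suc n))) (s k : ℕ) (xs : Vec ℕ n) {y : ℕ} →
                ⟦ prec (approx t) (precStep (approx u)) ⟧ (k ∷ s ∷ xs) ≡ suc y → prec t u [ k ∷ xs ]⇓ y
search-sound  : (t : Rec (suc n)) (s k : ℕ) (xs : Vec ℕ n) →
                Found t xs k (⟦ search (approx t) ⟧ (k ∷ s ∷ xs))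

approx-sound zeroᵣ       s []       refl = ⇓zero
approx-sound sucᵣ        s (x ∷ []) refl = ⇓suc
approx-sound (proj i)    s xs       refl = ⇓proj i
approx-sound (comp t us) s xs       eq   =
  let us≡ , t≡ = guard-suc⁻ (approx* us) eq
  in ⇓comp (approx*-sound us s xs us≡) (approx-sound t s _ t≡)
approx-sound (prec t u)  s (k ∷ xs) eq   =
  prec-sound t u s k xs (trans (sym (approx-prec t u s k xs)) eq)
approx-sound (min t)     s xs       eq
  rewrite ⟦params⟧ (s ∷ []) xs
  with ⟦ search (approx t) ⟧ (s ∷ s ∷ xs) | search-sound t s s xs
approx-sound (min t)     s xs       refl | suc (suc _) | found = found

approx*-sound []       s xs {[]}     eq = []
approx*-sound (u ∷ us) s xs {y ∷ ys} eq =
  let u≡ , us≡ = ∷-injective eq in approx-sound u s xs u≡ ∷ approx*-sound us s xs us≡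

prec-sound t u s zero    xs eq = ⇓prec-zero (approx-sound t s xs eq)
prec-sound t u s (suc k) xs eq
  with ⟦ prec (approx t) (precStep (approx u)) ⟧ (k ∷ s ∷ xs) in prev
... | suc r rewrite ⟦params⟧ (k ∷ suc r ∷ s ∷ []) xs =
  ⇓prec-suc (prec-sound t u s k xs prev) (approx-sound u s _ eq)

search-sound t s zero    xs = λ _ ()
search-sound t s (suc k) xs with ⟦ search (approx t) ⟧ (k ∷ s ∷ xs) | search-sound t s k xs
... | suc zero    | _     = tt
... | suc (suc _) | found = found
... | zero        | below
  rewrite ⟦params⟧ (k ∷ 0 ∷ s ∷ []) xs
  with ⟦ approx t ⟧ (s ∷ k ∷ xs) in now
-- The values 0, 1 and 2 + r mean no result, result 0 and result 1 + r; only the last lets the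
-- search continue.
...   | zero        = tt
...   | suc zero    = ⇓min below (approx-sound t s _ now)
...   | suc (suc r) = λ j j<1+k → [ below j , (λ { refl → r , approx-sound t s _ now }) ]
                                    (m≤n⇒m<n∨m≡n (s≤s⁻¹ j<1+k))

-- Completeness of bounded evaluation for all large bounds

Eventually : (ℕ → Set) → Set
Eventually P = ∃ λ N → ∀ s → N ≤ s → P s

eventually-× : ∀ {P Q : ℕ → Set} → Eventually P → Eventually Q → Eventually (λ s → P s × Q s)
eventually-× (M , p) (N , q) =
  M ⊔ N , λ s M⊔N≤s → p s (m⊔n≤o⇒m≤o M N M⊔N≤s) , q s (m⊔n≤o⇒n≤o M N M⊔N≤s)

eventually-map : ∀ {P Q : ℕ → Set} → (∀ {s} → P s → Q s) → Eventually P → Eventually Q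
eventually-map f (N , p) = N , λ s N≤s → f (p s N≤s)

eventually-∀< : ∀ {P : ℕ → ℕ → Set} b → (∀ k → k < b → Eventually (P k)) →
                Eventually (λ s → ∀ k → k < b → P k s)
eventually-∀< zero    h = 0 , λ _ _ _ ()
eventually-∀< (suc b) h =
  eventually-map
    (λ { (ps , p) k k<1+b → [ ps k , (λ { refl → p }) ] (m≤n⇒m<n∨m≡n (s≤s⁻¹ k<1+b)) })
    (eventually-× (eventually-∀< b (λ k k<b → h k (≤-trans k<b (n≤1+n b)))) (h b ≤-refl))

module _ (p : PR (suc (suc n))) (s : ℕ) (xs : Vec ℕ n) where

  search-continues : ∀ b → (∀ k → k < b → ∃ λ r → ⟦ p ⟧ (s ∷ k ∷ xs) ≡ suc (suc r)) →
                     ⟦ search p ⟧ (b ∷ s ∷ xs) ≡ 0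
  search-continues zero    h = refl
  search-continues (suc b) h
    rewrite search-continues b (λ k k<b → h k (≤-trans k<b (n≤1+n b)))
          | ⟦params⟧ (b ∷ 0 ∷ s ∷ []) xs
          | proj₂ (h b ≤-refl) = refl

  -- State 0 persists until `y` is tested, and state 2 + y ever after. The test of `y` is step
  -- number y + 1, whence `y < b`.
  search-finds : ∀ {y} → (∀ k → k < y → ∃ λ r → ⟦ p ⟧ (s ∷ k ∷ xs) ≡ suc (suc r)) →
                 ⟦ p ⟧ (s ∷ y ∷ xs) ≡ 1 →
                 ∀ b → y < b → ⟦ search p ⟧ (b ∷ s ∷ xs) ≡ suc (suc y)
  search-finds {y} below at (suc b) y<1+b with m≤n⇒m<n∨m≡n (s≤s⁻¹ y<1+b)
  ... | inj₁ y<b rewrite search-finds below at b y<b = refl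
  ... | inj₂ refl
    rewrite search-continues y below | ⟦params⟧ (y ∷ 0 ∷ s ∷ []) xs | at = refl

-- Asking for all large bounds instead of one lets subcomputations share a bound by taking maxima,
-- without a separate proof that `approx` is monotone in it.
approx-complete  : (t : Rec n) {xs : Vec ℕ n} {y : ℕ} → t [ xs ]⇓ y →
                   Eventually (λ s → ⟦ approx t ⟧ (s ∷ xs) ≡ suc y)
approx*-complete : (us : Vec (Rec n) m) {xs : Vec ℕ n} {ys : Vec ℕ m} →
                   Pointwise (λ u y → u [ xs ]⇓ y) us ys →
                   Eventually (λ s → ⟦ approx* us ⟧* (s ∷ xs) ≡ map suc ys)
prec-complete    : (t : Rec n) (u : Rec (suc (suc n))) {k : ℕ} {xs : Vec ℕ n} {y : ℕ} →
                   prec t u [ k ∷ xs ]⇓ y →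
                   Eventually (λ s → ⟦ prec (approx t) (precStep (approx u)) ⟧ (k ∷ s ∷ xs) ≡ suc y)

approx-complete zeroᵣ       ⇓zero     = 0 , λ _ _ → refl
approx-complete sucᵣ        ⇓suc      = 0 , λ _ _ → refl
approx-complete (proj i)    (⇓proj i) = 0 , λ _ _ → refl
approx-complete (comp t us) {xs} (⇓comp {ys = ys} ds d) =
  eventually-map
    (λ { {s} (us≡ , t≡) →
      let preds≡ , guard≡ = guard-suc (approx* us) ys us≡
      in trans guard≡ (trans (cong (λ zs → ⟦ approx t ⟧ (s ∷ zs)) preds≡) t≡) })
    (eventually-× (approx*-complete us ds) (approx-complete t d))
approx-complete (prec t u)  {k ∷ xs} d =
  eventually-map (λ {s} → trans (approx-prec t u s k xs)) (prec-complete t u d)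
approx-complete (min t)     {xs} {y} (⇓min below d) =
  eventually-map
    (λ { {s} ((pos , at) , y<s) → found s pos at y<s })
    -- The threshold `suc y` makes the search long enough to test `y` itself.
    (eventually-× (eventually-× positive (approx-complete t d)) (suc y , λ _ y<s → y<s))
  where
  positive = eventually-∀< y λ k k<y →
    eventually-map (λ eq → proj₁ (below k k<y) , eq) (approx-complete t (proj₂ (below k k<y)))
  found : ∀ s → (∀ k → k < y → ∃ λ r → ⟦ approx t ⟧ (s ∷ k ∷ xs) ≡ suc (suc r)) →
          ⟦ approx t ⟧ (s ∷ y ∷ xs) ≡ 1 → y < s → ⟦ approx (min t) ⟧ (s ∷ xs) ≡ suc y
  found s pos at y<s
    rewrite ⟦params⟧ (s ∷ []) xs | search-finds (approx t) s xs pos at s y<s = refl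

approx*-complete []       []       = 0 , λ _ _ → refl
approx*-complete (u ∷ us) (d ∷ ds) =
  eventually-map (λ { (u≡ , us≡) → cong₂ _∷_ u≡ us≡ })
    (eventually-× (approx-complete u d) (approx*-complete us ds))

prec-complete t u (⇓prec-zero d) = approx-complete t d
prec-complete t u {suc k} {xs} {y} (⇓prec-suc {r = r} d e) =
  eventually-map (λ { {s} (prev , now) → step s prev now })
    (eventually-× (prec-complete t u d) (approx-complete u e))
  where
  step : ∀ s → ⟦ prec (approx t) (precStep (approx u)) ⟧ (k ∷ s ∷ xs) ≡ suc r →
         ⟦ approx u ⟧ (s ∷ k ∷ r ∷ xs) ≡ suc y →
         ⟦ prec (approx t) (precStep (approx u)) ⟧ (suc k ∷ s ∷ xs) ≡ suc y
  step s prev now rewrite prev | ⟦params⟧ (k ∷ suc r ∷ s ∷ []) xs = now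

-- Simultaneous search

_[_]↓ : Rec n → Vec ℕ n → Set
t [ xs ]↓ = ∃ λ y → t [ xs ]⇓ y

-- As `p` is total, the values before `s` can be checked one by one: either a first zero turns up,
-- or all are positive and `s` is the least zero.
min-least : (p : PR (suc n)) {xs : Vec ℕ n} (s : ℕ) → ⟦ p ⟧ (s ∷ xs) ≡ 0 →
            ∃ λ y → min (toRec p) [ xs ]⇓ y × ⟦ p ⟧ (y ∷ xs) ≡ 0
min-least p {xs} s eq = [ (λ pos → s , least pos eq , eq) , id ] (scan s)
  where
  Positive : ℕ → Set
  Positive b = ∀ k → k < b → ∃ λ r → ⟦ p ⟧ (k ∷ xs) ≡ suc r

  least : ∀ {b} → Positive b → ⟦ p ⟧ (b ∷ xs) ≡ 0 → min (toRec p) [ xs ]⇓ b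
  least pos eq = ⇓min
    (λ k k<b → let r , eq′ = pos k k<b in r , subst (toRec p [ _ ]⇓_) eq′ (toRec-⇓ p _))
    (subst (toRec p [ _ ]⇓_) eq (toRec-⇓ p _))

  scan : ∀ b → Positive b ⊎ (∃ λ y → min (toRec p) [ xs ]⇓ y × ⟦ p ⟧ (y ∷ xs) ≡ 0)
  scan zero    = inj₁ λ _ ()
  scan (suc b) with scan b
  ... | inj₂ found = inj₂ found
  ... | inj₁ pos with ⟦ p ⟧ (b ∷ xs) in eq′
  ...   | zero  = inj₂ (b , least pos eq′ , eq′)
  ...   | suc r = inj₁ λ k k<1+b →
          [ pos k , (λ { refl → r , eq′ }) ] (m≤n⇒m<n∨m≡n (s≤s⁻¹ k<1+b))

module _ (t u : Rec n) where

  -- Zero encodes that a result has appeared, because `min` looks for zeros.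
  neither : PR (suc n)
  neither = if0 approx t then (if0 approx u then sucₚ zeroₚ else zeroₚ) else zeroₚ

  -- Ties go to `t`. The value 1 shows that `u` has a result only at bounds where `neither` is 0.
  winner : PR (suc n)
  winner = if0 approx t then sucₚ zeroₚ else zeroₚ

  race : Rec n
  race = comp (toRec winner) (min (toRec neither) ∷ toRec* (params 0))

  neither-eventually : ∀ {xs} → t [ xs ]↓ ⊎ u [ xs ]↓ → Eventually (λ s → ⟦ neither ⟧ (s ∷ xs) ≡ 0)
  neither-eventually {xs} (inj₁ (_ , d)) = eventually-map t-halts (approx-complete t d)
    where
    t-halts : ∀ {s y} → ⟦ approx t ⟧ (s ∷ xs) ≡ suc y → ⟦ neither ⟧ (s ∷ xs) ≡ 0
    t-halts eq rewrite eq = refl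
  neither-eventually {xs} (inj₂ (_ , d)) = eventually-map u-halts (approx-complete u d)
    where
    u-halts : ∀ {s y} → ⟦ approx u ⟧ (s ∷ xs) ≡ suc y → ⟦ neither ⟧ (s ∷ xs) ≡ 0
    u-halts {s} eq rewrite eq with ⟦ approx t ⟧ (s ∷ xs)
    ... | zero  = refl
    ... | suc _ = refl

  winner-correct : ∀ s xs → ⟦ neither ⟧ (s ∷ xs) ≡ 0 →
                   (⟦ winner ⟧ (s ∷ xs) ≡ 0 × t [ xs ]↓) ⊎ (⟦ winner ⟧ (s ∷ xs) ≡ 1 × u [ xs ]↓)
  winner-correct s xs eq with ⟦ approx t ⟧ (s ∷ xs) in t≡ | ⟦ approx u ⟧ (s ∷ xs) in u≡
  ... | suc _ | _     = inj₁ (refl , _ , approx-sound t s xs t≡)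
  ... | zero  | suc _ = inj₂ (refl , _ , approx-sound u s xs u≡)

  race-correct : ∀ {xs} → t [ xs ]↓ ⊎ u [ xs ]↓ →
                 (race [ xs ]⇓ 0 × t [ xs ]↓) ⊎ (race [ xs ]⇓ 1 × u [ xs ]↓)
  race-correct {xs} halts =
    let N , halted = neither-eventually halts
        s , d , eq = min-least neither N (halted N ≤-refl)
        race⇓ = ⇓comp (d ∷ subst (Pointwise _ _) (⟦params⟧ [] xs) (toRec*-⇓ (params 0) xs))
                      (toRec-⇓ winner (s ∷ xs))
    in [ (λ (w≡ , t↓) → inj₁ (subst (race [ xs ]⇓_) w≡ race⇓ , t↓))
       , (λ (w≡ , u↓) → inj₂ (subst (race [ xs ]⇓_) w≡ race⇓ , u↓))
       ] (winner-correct s xs eq)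

-- The fixed point

module _ (N : AcceptableNumbering) where
  open AcceptableNumbering N

  private
    univ : Rec 2
    univ = proj₁ universal

  -- The term ignores its input `x`, so `d a` is an index of the constant function with value φₐ(a),
  -- nowhere defined if φₐ(a) is undefined.
  self-application : ∃ λ (d : ℕ → ℕ) → Computable {1} (λ { (a ∷ []) → d a }) ×
                     (∀ a x y → φ a a y → φ (d a) x y)
  self-application =
    let s , (t , s⇔t) , φs⇔ = smn (comp univ (proj 1F ∷ proj 1F ∷ []))
    in (λ a → s (a ∷ [])) , (t , λ { (a ∷ []) → s⇔t (a ∷ []) }) ,
       λ a x y φaa → from (φs⇔ (a ∷ []) x y)
         (⇓comp (⇓proj 1F ∷ ⇓proj 1F ∷ []) (to (proj₂ universal (a ∷ a ∷ []) y) φaa))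

  -- Diagonalisation: let g(i,j) be an index of the map from e to q(d(e),i,j). Applied to its own
  -- index, it gives q(p,i,j) with p = d(g(i,j)), and this is the constant value of φₚ. Constant
  -- functions suffice, since `q` does not read the input of φₚ.
  recursion-theorem : (q : Rec 3) →
    ∃ λ (f : Vec ℕ 2 → ℕ) → Computable f ×
      (∀ i j → let p = f (i ∷ j ∷ []) in ∀ x y → q [ p ∷ i ∷ j ∷ [] ]⇓ y → φ p x y)
  recursion-theorem q =
    let d , (dᵣ , d⇔) , φd = self-application
        g , (gᵣ , g⇔) , φg⇔ = smn (comp q (comp dᵣ (proj 0F ∷ []) ∷ proj 1F ∷ proj 2F ∷ []))
    in d ∘ g ,
       (comp dᵣ (gᵣ ∷ []) , λ as y → mk⇔
         (λ eq → ⇓comp (to (g⇔ as _) refl ∷ []) (to (d⇔ (_ ∷ []) y) eq))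
         (λ { (⇓comp (g⇓ ∷ []) d⇓) → trans (cong d (from (g⇔ as _) g⇓)) (from (d⇔ (_ ∷ []) y) d⇓) })) ,
       λ i j x y q⇓ → φd _ x y (from (φg⇔ (i ∷ j ∷ []) _ y)
         (⇓comp (⇓comp (⇓proj 0F ∷ []) (to (d⇔ (_ ∷ []) _) refl) ∷ ⇓proj 1F ∷ ⇓proj 2F ∷ []) q⇓))

  -- The universal program is raced on (i, p) against (j, p). The outputs are crossed: a program
  -- with output 0 belongs to `E₀`, yet 0 is given when `p` is found in `W i`, the set meant to
  -- contain `𝐌`.
  selector : ∃ λ (q : Rec 3) → ∀ {p i j} → (W i ∪ W j) p →
             (q [ p ∷ i ∷ j ∷ [] ]⇓ 0 × W i p) ⊎ (q [ p ∷ i ∷ j ∷ [] ]⇓ 1 × W j p)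
  selector = race inᵢ inⱼ ,
    Sum.map (Product.map₂ unwrapᵢ) (Product.map₂ unwrapⱼ) ∘ race-correct inᵢ inⱼ ∘ Sum.map wrapᵢ wrapⱼ
    where
    inᵢ inⱼ : Rec 3
    inᵢ = comp univ (proj 1F ∷ proj 0F ∷ [])
    inⱼ = comp univ (proj 2F ∷ proj 0F ∷ [])

    module _ {p i j : ℕ} where
      wrapᵢ : W i p → inᵢ [ p ∷ i ∷ j ∷ [] ]↓
      wrapᵢ (y , φy) = y , ⇓comp (⇓proj 1F ∷ ⇓proj 0F ∷ []) (to (proj₂ universal _ y) φy)

      wrapⱼ : W j p → inⱼ [ p ∷ i ∷ j ∷ [] ]↓
      wrapⱼ (y , φy) = y , ⇓comp (⇓proj 2F ∷ ⇓proj 0F ∷ []) (to (proj₂ universal _ y) φy)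

      unwrapᵢ : inᵢ [ p ∷ i ∷ j ∷ [] ]↓ → W i p
      unwrapᵢ (y , ⇓comp (⇓proj _ ∷ ⇓proj _ ∷ []) u⇓) = y , from (proj₂ universal (i ∷ p ∷ []) y) u⇓

      unwrapⱼ : inⱼ [ p ∷ i ∷ j ∷ [] ]↓ → W j p
      unwrapⱼ (y , ⇓comp (⇓proj _ ∷ ⇓proj _ ∷ []) u⇓) = y , from (proj₂ universal (j ∷ p ∷ []) y) u⇓

theorem7p5 : (N : AcceptableNumbering) →
    let open AcceptableNumbering N in
    EffectivelyInseparable 𝐌 E₀
theorem7p5 N =
  let q , select = selector N
      f , (fᵣ , f⇔) , φf = recursion-theorem N q
  in (λ i j → f (i ∷ j ∷ [])) , (fᵣ , λ { (i ∷ j ∷ []) → f⇔ (i ∷ j ∷ []) }) ,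
     λ i j 𝐌⊆Wᵢ E₀⊆Wⱼ disjoint f∈Wᵢ∪Wⱼ →
       -- Of the two numerals after `φf i j`, the first is the input 0 used in defining `𝐌` and
       -- `E₀`, the second the output.
       [ (λ (q⇓0 , f∈Wᵢ) → disjoint _ (f∈Wᵢ , E₀⊆Wⱼ (φf i j 0 0 q⇓0)))
       , (λ (q⇓1 , f∈Wⱼ) → disjoint _ (𝐌⊆Wᵢ (φf i j 0 1 q⇓1) , f∈Wⱼ))
       ] (select f∈Wᵢ∪Wⱼ)
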